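{- The satisfiability problem for $\mathrm{LRP}$ formulas is undecidable: there is no algorithm that, given an $\mathrm{LRP}$ formula, decides whether some graph satisfies it.
   Context: A vocabulary is $\tau=\langle C,U,F\rangle$, where $C$ is a finite set of constant symbols, $U$ a set of unary relation symbols and $F$ a finite set of binary relation symbols (edge labels). A graph (interpretation) over $\tau$ is $G=\langle V,E,C^G,U^G\rangle$ with $V$ a set of nodes, $E(f)\subseteq V\times V$ for $f\in F$, $C^G(c)\in V$ for $c\in C$, and $U^G(u)\subseteq V$ for $u\in U$. Terms are variables or constants; atomic formulas are $t=t'$, $u(t)$ and $t\xrightarrow{f}t'$ (meaning $(t,t')\in E(f)$); quantifier-free formulas are Boolean combinations of atomic formulas. Routing expressions are given by the grammar $R::=\emptyset\mid\epsilon\mid \xrightarrow{f}\mid \xleftarrow{f}\mid u\mid\neg u\mid c\mid \neg c\mid R_1.R_2\mid R_1|R_2\mid R^*$ ($f\in F,u\in U,c\in C$), denoting a language $L(R)$ of words over the letters $\xrightarrow{f},\xleftarrow{f},u,\neg u,c,\neg c$. A path labelled by a word $w$ from node $a$ to node $b$ is defined by: $\epsilon$: $a=b$; $\xrightarrow{f}$: $(a,b)\in E(f)$; $\xleftarrow{f}$: $(b,a)\in E(f)$; $u$: $a=b\in U^G(u)$; $\neg u$: $a=b\notin U^G(u)$; $c$: $a=b=C^G(c)$; $\neg c$: $a=b\neq C^G(c)$; and a word $w_1w_2$ labels a path from $a$ to $b$ iff there is a node $d$ with a $w_1$-path from $a$ to $d$ and a $w_2$-path from $d$ to $b$. An $R$-path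 is a path labelled by some word of $L(R)$. A neighborhood formula $N(v_0,\dots,v_n)$ is a conjunction of edge atoms $v_i\xrightarrow{f}v_j$. A reachability constraint, written $[c,R]p$, is a closed formula $\forall v_0,\dots,v_n.\ R(c,v_0)\Rightarrow(N(v_0,\dots,v_n)\Rightarrow\psi(v_0,\dots,v_n))$ where $c\in C$, $R$ is a routing expression, $N$ is a neighborhood formula, $\psi$ is quantifier-free, the free variables of $N$ are among $v_0,\dots,v_n$ and those of $\psi$ are among $FV(N)\cup\{v_0\}$; $p(v_0):=N\Rightarrow\psi$ is its pattern. A graph $G$ satisfies it iff for every node $a$ reachable by an $R$-path from $C^G(c)$ and every assignment of nodes to $v_0,\dots,v_n$ with $v_0\mapsto a$, the assignment satisfies $N\Rightarrow\psi$. An $\mathrm{LRP}$ formula is a Boolean combination of reachability constraints, with the usual semantics of Boolean connectives. -}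

module Defs where

open import Data.Nat using (ℕ; zero; suc; _+_; _<_)
open import Data.Fin using (Fin; toℕ)
open import Data.Vec using (Vec; []; _∷_)
open import Data.List using (List; []; _∷_; _++_)
open import Data.List.Relation.Unary.All using (All)
open import Data.List.Relation.Unary.Any using (Any)
open import Data.Product using (Σ; _×_; _,_)
open import Data.Sum using (_⊎_)
open import Data.Empty using (⊥)
open import Relation.Nullary using (¬_)
open import Relation.Binary.PropositionalEquality using (_≡_)

-- Symbols.  Constant, unary and binary (edge-label) symbols are all
-- drawn from ℕ.  A formula mentions only finitely many of them; graphs
-- interpret every symbol.

Const Unary Label : Set
Const = ℕ
Unary = ℕ
Label = ℕ

record Graph (V : Set) : Set₁ where
  field
    E  : Label → V → V → Set
    Cn : Const → V
    Un : Unary → V → Set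
open Graph public

data Letter : Set where
  lFwd lBwd : Label → Letter
  lU   lNU  : Unary → Letter
  lC   lNC  : Const → Letter

data RExp : Set where
  rEmpty rEps : RExp
  rFwd rBwd   : Label → RExp
  rU rNU      : Unary → RExp
  rC rNC      : Const → RExp
  rSeq rAlt   : RExp → RExp → RExp
  rStar       : RExp → RExp

data Lang : RExp → List Letter → Set where
  eps   : Lang rEps []
  fwd   : ∀ {f} → Lang (rFwd f) (lFwd f ∷ [])
  bwd   : ∀ {f} → Lang (rBwd f) (lBwd f ∷ [])
  uu    : ∀ {u} → Lang (rU u) (lU u ∷ [])
  nu    : ∀ {u} → Lang (rNU u) (lNU u ∷ [])
  cc    : ∀ {c} → Lang (rC c) (lC c ∷ [])
  nc    : ∀ {c} → Lang (rNC c) (lNC c ∷ [])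
  seq   : ∀ {R S w₁ w₂} → Lang R w₁ → Lang S w₂ → Lang (rSeq R S) (w₁ ++ w₂)
  altˡ  : ∀ {R S w} → Lang R w → Lang (rAlt R S) w
  altʳ  : ∀ {R S w} → Lang S w → Lang (rAlt R S) w
  star0 : ∀ {R} → Lang (rStar R) []
  starS : ∀ {R w₁ w₂} → Lang R w₁ → Lang (rStar R) w₂ → Lang (rStar R) (w₁ ++ w₂)

Step : ∀ {V} → Graph V → Letter → V → V → Set
Step G (lFwd f) a b = E G f a b
Step G (lBwd f) a b = E G f b a
Step G (lU u)   a b = a ≡ b × Un G u a
Step G (lNU u)  a b = a ≡ b × ¬ Un G u a
Step G (lC c)   a b = a ≡ b × b ≡ Cn G c
Step G (lNC c)  a b = a ≡ b × ¬ (a ≡ Cn G c)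

data WPath {V : Set} (G : Graph V) : List Letter → V → V → Set where
  nil  : ∀ {a} → WPath G [] a a
  cons : ∀ {l w a d b} → Step G l a d → WPath G w d b → WPath G (l ∷ w) a b

RPath : ∀ {V} → Graph V → RExp → V → V → Set
RPath G R a b = Σ (List Letter) λ w → Lang R w × WPath G w a b

data Term (k : ℕ) : Set where
  var : Fin k → Term k
  con : Const → Term k

data QF (k : ℕ) : Set where
  qEq   : Term k → Term k → QF k
  qU    : Unary → Term k → QF k
  qEdge : Term k → Label → Term k → QF k
  qNot  : QF k → QF k
  qAnd qOr : QF k → QF k → QF k

data VarInTerm {k} (x : Fin k) : Term k → Set where
  here : VarInTerm x (var x)

data VarIn {k} (x : Fin k) : QF k → Set where
  eqˡ  : ∀ {t t'} → VarInTerm x t → VarIn x (qEq t t')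
  eqʳ  : ∀ {t t'} → VarInTerm x t' → VarIn x (qEq t t')
  un   : ∀ {u t} → VarInTerm x t → VarIn x (qU u t)
  edˡ  : ∀ {t f t'} → VarInTerm x t → VarIn x (qEdge t f t')
  edʳ  : ∀ {t f t'} → VarInTerm x t' → VarIn x (qEdge t f t')
  not  : ∀ {φ} → VarIn x φ → VarIn x (qNot φ)
  andˡ : ∀ {φ ψ} → VarIn x φ → VarIn x (qAnd φ ψ)
  andʳ : ∀ {φ ψ} → VarIn x ψ → VarIn x (qAnd φ ψ)
  orˡ  : ∀ {φ ψ} → VarIn x φ → VarIn x (qOr φ ψ)
  orʳ  : ∀ {φ ψ} → VarIn x ψ → VarIn x (qOr φ ψ)

-- Neighborhood formulas: conjunctions of edge atoms v_i →f v_j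

record EdgeAtom (k : ℕ) : Set where
  constructor edgeAtom
  field
    src : Fin k
    lbl : Label
    tgt : Fin k

Nbhd : ℕ → Set
Nbhd k = List (EdgeAtom k)

VarInN : ∀ {k} → Fin k → Nbhd k → Set
VarInN x N = Any (λ a → x ≡ EdgeAtom.src a ⊎ x ≡ EdgeAtom.tgt a) N

-- Reachability constraints [c,R]p  with variables v_0 … v_n  (= Fin (suc n))

record RC : Set where
  constructor rc
  field
    c   : Const
    R   : RExp
    n   : ℕ
    N   : Nbhd (suc n)
    ψ   : QF (suc n)

WFRC : RC → Set
WFRC (rc c R n N ψ) = ∀ (x : Fin (suc n)) → VarIn x ψ → x ≡ Fin.zero ⊎ VarInN x N

data LRP : Set where
  atom : RC → LRP
  lNot : LRP → LRP
  lAnd lOr : LRP → LRP → LRP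

data WF : LRP → Set where
  atom : ∀ {r} → WFRC r → WF (atom r)
  lNot : ∀ {φ} → WF φ → WF (lNot φ)
  lAnd : ∀ {φ ψ} → WF φ → WF ψ → WF (lAnd φ ψ)
  lOr  : ∀ {φ ψ} → WF φ → WF ψ → WF (lOr φ ψ)

module _ {V : Set} (G : Graph V) where

  evalT : ∀ {k} → (Fin k → V) → Term k → V
  evalT ρ (var x) = ρ x
  evalT ρ (con c) = Cn G c

  ⟦_⟧Q : ∀ {k} → QF k → (Fin k → V) → Set
  ⟦ qEq t t' ⟧Q ρ    = evalT ρ t ≡ evalT ρ t'
  ⟦ qU u t ⟧Q ρ      = Un G u (evalT ρ t)
  ⟦ qEdge t f t' ⟧Q ρ = E G f (evalT ρ t) (evalT ρ t')
  ⟦ qNot φ ⟧Q ρ      = ¬ ⟦ φ ⟧Q ρ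
  ⟦ qAnd φ ψ ⟧Q ρ    = ⟦ φ ⟧Q ρ × ⟦ ψ ⟧Q ρ
  ⟦ qOr φ ψ ⟧Q ρ     = ⟦ φ ⟧Q ρ ⊎ ⟦ ψ ⟧Q ρ

  ⟦_⟧N : ∀ {k} → Nbhd k → (Fin k → V) → Set
  ⟦ N ⟧N ρ = All (λ a → E G (EdgeAtom.lbl a) (ρ (EdgeAtom.src a)) (ρ (EdgeAtom.tgt a))) N

  SatRC : RC → Set
  SatRC (rc c R n N ψ) =
    ∀ (a : V) → RPath G R (Cn G c) a →
    ∀ (ρ : Fin (suc n) → V) → ρ Fin.zero ≡ a → ⟦ N ⟧N ρ → ⟦ ψ ⟧Q ρ

  _⊨_ : LRP → Set
  _⊨_ (atom r)    = SatRC r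
  _⊨_ (lNot φ)    = ¬ (_⊨_ φ)
  _⊨_ (lAnd φ ψ)  = _⊨_ φ × _⊨_ ψ
  _⊨_ (lOr φ ψ)   = _⊨_ φ ⊎ _⊨_ ψ

Satisfiable : LRP → Set₁
Satisfiable φ = Σ Set λ V → Σ (Graph V) λ G → _⊨_ G φ

data Rec : ℕ → Set where
  zer  : ∀ {k} → Rec k
  succ : Rec 1
  proj : ∀ {k} → Fin k → Rec k
  comp : ∀ {k m} → Rec m → Vec (Rec k) m → Rec k
  prec : ∀ {k} → Rec k → Rec (suc (suc k)) → Rec (suc k)
  mu   : ∀ {k} → Rec (suc k) → Rec k

lookupV : ∀ {A : Set} {k} → Vec A k → Fin k → A
lookupV (x ∷ xs) Fin.zero    = x
lookupV (x ∷ xs) (Fin.suc i) = lookupV xs i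

mutual
  data Eval : ∀ {k} → Rec k → Vec ℕ k → ℕ → Set where
    eZer  : ∀ {k} {xs : Vec ℕ k} → Eval zer xs 0
    eSucc : ∀ {x} → Eval succ (x ∷ []) (suc x)
    eProj : ∀ {k} {i : Fin k} {xs} → Eval (proj i) xs (lookupV xs i)
    eComp : ∀ {k m} {f : Rec m} {gs : Vec (Rec k) m} {xs ys y} →
            EvalAll gs xs ys → Eval f ys y → Eval (comp f gs) xs y
    ePrec0 : ∀ {k} {f : Rec k} {g xs y} → Eval f xs y → Eval (prec f g) (0 ∷ xs) y
    ePrecS : ∀ {k} {f : Rec k} {g xs n r y} →
             Eval (prec f g) (n ∷ xs) r → Eval g (n ∷ r ∷ xs) y →
             Eval (prec f g) (suc n ∷ xs) y
    eMu   : ∀ {k} {f : Rec (suc k)} {xs y} →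
            Eval f (y ∷ xs) 0 →
            (∀ z → z < y → Σ ℕ λ m → Eval f (z ∷ xs) (suc m)) →
            Eval (mu f) xs y

  data EvalAll {k} : ∀ {m} → Vec (Rec k) m → Vec ℕ k → Vec ℕ m → Set where
    []  : ∀ {xs} → EvalAll [] xs []
    _∷_ : ∀ {m g y} {gs : Vec (Rec k) m} {xs ys} →
          Eval g xs y → EvalAll gs xs ys → EvalAll (g ∷ gs) xs (y ∷ ys)

-- Gödel encoding of LRP formulas into ℕ (Cantor pairing)

tri : ℕ → ℕ
tri zero    = 0
tri (suc n) = suc n + tri n

pair : ℕ → ℕ → ℕ
pair a b = tri (a + b) + b

encList : ∀ {A : Set} → (A → ℕ) → List A → ℕ
encList e []       = 0
encList e (x ∷ xs) = suc (pair (e x) (encList e xs))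

encR : RExp → ℕ
encR rEmpty     = pair 0 0
encR rEps       = pair 1 0
encR (rFwd f)   = pair 2 f
encR (rBwd f)   = pair 3 f
encR (rU u)     = pair 4 u
encR (rNU u)    = pair 5 u
encR (rC c)     = pair 6 c
encR (rNC c)    = pair 7 c
encR (rSeq R S) = pair 8 (pair (encR R) (encR S))
encR (rAlt R S) = pair 9 (pair (encR R) (encR S))
encR (rStar R)  = pair 10 (encR R)

encT : ∀ {k} → Term k → ℕ
encT (var x) = pair 0 (toℕ x)
encT (con c) = pair 1 c

encQ : ∀ {k} → QF k → ℕ
encQ (qEq t t')     = pair 0 (pair (encT t) (encT t'))
encQ (qU u t)       = pair 1 (pair u (encT t))
encQ (qEdge t f t') = pair 2 (pair (encT t) (pair f (encT t')))
encQ (qNot φ)       = pair 3 (encQ φ)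
encQ (qAnd φ ψ)     = pair 4 (pair (encQ φ) (encQ ψ))
encQ (qOr φ ψ)      = pair 5 (pair (encQ φ) (encQ ψ))

encE : ∀ {k} → EdgeAtom k → ℕ
encE (edgeAtom i f j) = pair (toℕ i) (pair f (toℕ j))

encRC : RC → ℕ
encRC (rc c R n N ψ) =
  pair c (pair (encR R) (pair n (pair (encList encE N) (encQ ψ))))

⌜_⌝ : LRP → ℕ
⌜ atom r ⌝    = pair 0 (encRC r)
⌜ lNot φ ⌝    = pair 1 ⌜ φ ⌝
⌜ lAnd φ ψ ⌝  = pair 2 (pair ⌜ φ ⌝ ⌜ ψ ⌝)
⌜ lOr φ ψ ⌝   = pair 3 (pair ⌜ φ ⌝ ⌜ ψ ⌝)

DecidesLRPSat : Rec 1 → Set₁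
DecidesLRPSat D =
  ∀ (φ : LRP) → WF φ →
  Σ ℕ λ b → Eval D (⌜ φ ⌝ ∷ []) b
          × ((b ≡ 1 → Satisfiable φ) × (Satisfiable φ → b ≡ 1))

{-# OPTIONS --safe #-}
-- Routing expressions assert the existence of a finite chain of nodes 0, 1, …, B from constant 0
-- to constant 1, and reachability constraints express Horn clauses over edges.  Evaluation of a
-- unary program (f x = y as an edge labelled f from x to y, with Cantor pairing for tuples) is
-- axiomatised by such clauses.  They compute on demand, and a demanded number beyond B is a
-- contradiction.  So if f halts on n, the clauses together with "f n ≠ 1" have a model exactly
-- when f n ≠ 1.  Since the argument n is supplied by a separate conjunct inputIs n, the Gödel
-- number of ψ ∧ inputIs ⌜ψ⌝ is a simple function of ⌜ψ⌝; letting f compute a purported decision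
-- procedure on that number, with ψ the clauses for f, gives the contradiction.
module Submission where

open import Defs
open import Data.Nat using (ℕ; zero; suc; _+_; _≤_; _<_; z≤n; s≤s; _⊔_)
open import Data.Nat.Properties
open import Data.Fin using (Fin; toℕ)
open import Data.Fin.Patterns
open import Data.Fin.Properties using (toℕ-injective) renaming (_≟_ to _≟F_)
open import Data.Vec using (Vec; []; _∷_)
open import Data.Vec.Functional using () renaming (_∷_ to _◃_; [] to ∅)
open import Data.List using (List; []; _∷_; _++_; map)
open import Data.List.Relation.Unary.All using (All; []; _∷_)
import Data.List.Relation.Unary.All as All
import Data.List.Relation.Unary.All.Properties as All
open import Data.List.Relation.Unary.Any using (Any; any?)
import Data.List.Relation.Unary.Any.Properties as Any
open import Data.Product using (Σ; ∃; _×_; _,_; proj₁; proj₂)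
open import Data.Sum using (_⊎_; inj₁; inj₂)
open import Data.Unit using (⊤; tt)
open import Data.Empty using (⊥)
open import Relation.Nullary using (¬_; Dec; yes; no; contradiction)
open import Relation.Nullary.Decidable using (True; toWitness; _×-dec_; _⊎-dec_)
open import Relation.Binary.PropositionalEquality
  using (_≡_; _≢_; refl; sym; trans; cong; cong₂; subst; module ≡-Reasoning)

-- Cantor pairing as an enumeration.

infixr 5 _⋆_

opaque
  -- Opacity keeps unification from unfolding the arithmetic of pair.
  _⋆_ : ℕ → ℕ → ℕ
  a ⋆ b = pair a b

  -- One step along an antidiagonal; `⋆-zero` passes from the end of one antidiagonal to the start
  -- of the next. With `⋆-origin` they determine the pairing by successors alone, so Horn rules over
  -- next-edges can express it.
  ⋆-suc : ∀ a b → a ⋆ suc b ≡ suc (suc a ⋆ b)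
  ⋆-suc a b = begin
    tri (a + suc b) + suc b     ≡⟨ cong (λ s → tri s + suc b) (+-suc a b) ⟩
    tri (suc a + b) + suc b     ≡⟨ +-suc (tri (suc a + b)) b ⟩
    suc (tri (suc a + b) + b)   ∎
    where open ≡-Reasoning

  ⋆-zero : ∀ a → suc a ⋆ 0 ≡ suc (0 ⋆ a)
  ⋆-zero a = begin
    tri (suc a + 0) + 0   ≡⟨ +-identityʳ _ ⟩
    tri (suc a + 0)       ≡⟨ cong tri (+-identityʳ (suc a)) ⟩
    suc (a + tri a)       ≡⟨ cong suc (+-comm a (tri a)) ⟩
    suc (tri a + a)       ∎
    where open ≡-Reasoning

  ⋆-origin : 0 ⋆ 0 ≡ 0
  ⋆-origin = refl

  fst≤⋆ : ∀ a b → a ≤ a ⋆ b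
  fst≤⋆ a b = ≤-trans (m≤m+n a b) (≤-trans (m≤tri-m (a + b)) (m≤m+n (tri (a + b)) b))
    where
    m≤tri-m : ∀ m → m ≤ tri m
    m≤tri-m zero    = z≤n
    m≤tri-m (suc m) = m≤m+n (suc m) (tri m)

  snd≤⋆ : ∀ a b → b ≤ a ⋆ b
  snd≤⋆ a b = m≤n+m b (tri (a + b))

-- Descends along the enumeration (0,0), (1,0), (0,1), (2,0), … of all pairs.
⋆-elim : (P : ℕ → ℕ → ℕ → Set) → P 0 0 0 →
         (∀ {w a b} → w ≡ suc a ⋆ b → P w (suc a) b → P (suc w) a (suc b)) →
         (∀ {w a} → w ≡ 0 ⋆ a → P w 0 a → P (suc w) (suc a) 0) →
         ∀ {w} a b → w ≡ a ⋆ b → P w a b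
⋆-elim P p₀ pˢ pᶻ a b e = go _ a b e
  where
  go : ∀ w a b → w ≡ a ⋆ b → P w a b
  go zero    zero    zero    _ = p₀
  go (suc w) zero    zero    e = contradiction (trans e ⋆-origin) λ ()
  go zero    a       (suc b) e = contradiction (trans e (⋆-suc a b)) λ ()
  go (suc w) a       (suc b) e = let e′ = suc-injective (trans e (⋆-suc a b)) in
                                 pˢ e′ (go w (suc a) b e′)
  go zero    (suc a) zero    e = contradiction (trans e (⋆-zero a)) λ ()
  go (suc w) (suc a) zero    e = let e′ = suc-injective (trans e (⋆-zero a)) in
                                 pᶻ e′ (go w 0 a e′)

-- Both pairs descend the enumeration in step. If one moves along an antidiagonal while the other
-- changes antidiagonals, the predecessors have first components `suc _` and 0, against the
-- induction hypothesis.
⋆-injective : ∀ {a b c d} → a ⋆ b ≡ c ⋆ d → a ≡ c × b ≡ d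
⋆-injective {a} {b} {c} {d} e = ⋆-elim
  (λ w a b → ∀ c d → w ≡ c ⋆ d → a ≡ c × b ≡ d) base diag reset a b refl c d e
  where
  base : ∀ c d → 0 ≡ c ⋆ d → 0 ≡ c × 0 ≡ d
  base zero    zero    _ = refl , refl
  base c       (suc d) e = contradiction (trans e (⋆-suc c d)) λ ()
  base (suc c) zero    e = contradiction (trans e (⋆-zero c)) λ ()

  diag : ∀ {w a b} → w ≡ suc a ⋆ b → (∀ c d → w ≡ c ⋆ d → suc a ≡ c × b ≡ d) →
         ∀ c d → suc w ≡ c ⋆ d → a ≡ c × suc b ≡ d
  diag _ ih zero    zero    e = contradiction (trans e ⋆-origin) λ ()
  diag _ ih c       (suc d) e with refl , refl ← ih (suc c) d (suc-injective (trans e (⋆-suc c d)))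
    = refl , refl
  diag _ ih (suc c) zero    e with () ← proj₁ (ih 0 c (suc-injective (trans e (⋆-zero c))))

  reset : ∀ {w a} → w ≡ 0 ⋆ a → (∀ c d → w ≡ c ⋆ d → 0 ≡ c × a ≡ d) →
          ∀ c d → suc w ≡ c ⋆ d → suc a ≡ c × 0 ≡ d
  reset _ ih zero    zero    e = contradiction (trans e ⋆-origin) λ ()
  reset _ ih c       (suc d) e with () ← proj₁ (ih (suc c) d (suc-injective (trans e (⋆-suc c d))))
  reset _ ih (suc c) zero    e with refl , refl ← ih 0 c (suc-injective (trans e (⋆-zero c)))
    = refl , refl

-- Horn rules as reachability constraints

module Horn (Lab : Set) (code : Lab → ℕ)
            (code-injective : ∀ {l m} → code l ≡ code m → l ≡ m)
            (next : Lab) where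

  Edge : ℕ → Set
  Edge k = Fin (suc k) × Lab × Fin (suc k)

  -- A routing expression constrains variable 0 only; through it the hypotheses of a rule can refer
  -- to the number 0 or to the input.
  data Anchor : Set where
    anywhere atZero atInput : Anchor

  data Mark : Set where
    zeroMark endMark : Mark

  data Concl (k : ℕ) : Set where
    edge : Edge k → Concl k
    _≠_  : Fin (suc k) → Mark → Concl k

  -- Mirrors `WFRC`; being decidable, it is discharged by evaluation in the implicit field `scoped`
  -- of each concrete rule.
  Covered : ∀ {k} → List (Edge k) → Fin (suc k) → Set
  Covered ps x = x ≡ 0F ⊎ Any (λ p → x ≡ proj₁ p ⊎ x ≡ proj₂ (proj₂ p)) ps

  covered? : ∀ {k} (ps : List (Edge k)) x → Dec (Covered ps x)
  covered? ps x =
    (x ≟F 0F) ⊎-dec any? (λ p → (x ≟F proj₁ p) ⊎-dec (x ≟F proj₂ (proj₂ p))) ps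

  Scoped : ∀ {k} → List (Edge k) → Concl k → Set
  Scoped ps (edge (x , _ , y)) = Covered ps x × Covered ps y
  Scoped ps (x ≠ _)            = Covered ps x

  scoped? : ∀ {k} (ps : List (Edge k)) c → Dec (Scoped ps c)
  scoped? ps (edge (x , _ , y)) = covered? ps x ×-dec covered? ps y
  scoped? ps (x ≠ _)            = covered? ps x

  record Rule : Set where
    constructor rule
    field
      k        : ℕ
      anchor   : Anchor
      premises : List (Edge k)
      concl    : Concl k
      {scoped} : True (scoped? premises concl)

  infixr 5 _∧_
  data Rules : Set where
    [_] : Rule → Rules
    _∧_ : Rules → Rules → Rules

  module _ (n B : ℕ) (H : Lab → ℕ → ℕ → Set) where

    Anchored : Anchor → ℕ → Set
    Anchored anywhere i = ⊤
    Anchored atZero   i = i ≡ 0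
    Anchored atInput  i = i ≡ n

    position : Mark → ℕ
    position zeroMark = 0
    position endMark  = B

    Holds : ∀ {k} → Edge k → (Fin (suc k) → ℕ) → Set
    Holds (x , l , y) ι = H l (ι x) (ι y)

    Concluded : ∀ {k} → Concl k → (Fin (suc k) → ℕ) → Set
    Concluded (edge e) ι = Holds e ι
    Concluded (x ≠ m)  ι = ι x ≢ position m

    ValidRule : Rule → Set
    ValidRule (rule k a ps c) =
      ∀ ι → Anchored a (ι 0F) → All (λ p → Holds p ι) ps → Concluded c ι

    Valid : Rules → Set
    Valid [ r ]   = ValidRule r
    Valid (Γ ∧ Δ) = Valid Γ × Valid Δ

  nextStar : RExp
  nextStar = rStar (rFwd (code next))

  route : Anchor → RExp
  route anywhere = nextStar
  route atZero   = rEps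
  route atInput  = rSeq nextStar (rU 0)

  edgeAtomOf : ∀ {k} → Edge k → EdgeAtom (suc k)
  edgeAtomOf (x , l , y) = edgeAtom x (code l) y

  constant : Mark → Const
  constant zeroMark = 0
  constant endMark  = 1

  conclQF : ∀ {k} → Concl k → QF (suc k)
  conclQF (edge (x , l , y)) = qEdge (var x) (code l) (var y)
  conclQF (x ≠ m)            = qNot (qEq (var x) (con (constant m)))

  ruleRC : Rule → RC
  ruleRC (rule k a ps c) = rc 0 (route a) k (map edgeAtomOf ps) (conclQF c)

  theory : Rules → LRP
  theory [ r ]   = atom (ruleRC r)
  theory (Γ ∧ Δ) = lAnd (theory Γ) (theory Δ)

  toEnd : RExp
  toEnd = rSeq (rU 0) (rSeq nextStar (rC 1))

  -- Nested to the right, so that a program can build its Gödel number by iterating a single step.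
  inputRoute : ℕ → RExp
  inputRoute zero    = toEnd
  inputRoute (suc n) = rSeq (rFwd (code next)) (inputRoute n)

  -- With a false pattern a constraint says that no node is reached, so its negation asserts a path.
  absurdQ : QF 1
  absurdQ = qNot (qEq (var 0F) (var 0F))

  -- The only existential constraint: a path of next-edges from constant 0 to constant 1
  -- whose n-th node carries the unary symbol 0.
  inputIs : ℕ → LRP
  inputIs n = lNot (atom (rc 0 (inputRoute n) 0 [] absurdQ))

  conclWF : ∀ {k} (ps : List (Edge k)) c → Scoped ps c → ∀ x → VarIn x (conclQF c) →
            x ≡ 0F ⊎ VarInN x (map edgeAtomOf ps)
  conclWF ps c sc x occ = lift (covers c sc occ)
    where
    covers : ∀ c → Scoped ps c → VarIn x (conclQF c) → Covered ps x
    covers (edge _) (s , _) (edˡ here) = s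
    covers (edge _) (_ , s) (edʳ here) = s
    covers (_ ≠ _)  s (not (eqˡ here)) = s

    lift : Covered ps x → x ≡ 0F ⊎ VarInN x (map edgeAtomOf ps)
    lift (inj₁ e) = inj₁ e
    lift (inj₂ i) = inj₂ (Any.map⁺ i)

  theoryWF : ∀ Γ → WF (theory Γ)
  theoryWF [ rule k a ps c {s} ] = atom (conclWF ps c (toWitness s))
  theoryWF (Γ ∧ Δ)               = lAnd (theoryWF Γ) (theoryWF Δ)

  inputWF : ∀ n → WF (inputIs n)
  inputWF n = lNot (atom λ { 0F _ → inj₁ refl })

  -- Passing between graphs and rules over numbers.

  _++ᵖ_ : ∀ {V} {G : Graph V} {v w a b c} → WPath G v a b → WPath G w b c → WPath G (v ++ w) a c
  nil      ++ᵖ q = q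
  cons s p ++ᵖ q = cons s (p ++ᵖ q)

  split : ∀ {V} {G : Graph V} v {w a c} → WPath G (v ++ w) a c →
          ∃ λ b → WPath G v a b × WPath G w b c
  split []      p          = _ , nil , p
  split (_ ∷ v) (cons s p) with b , q , r ← split v p = b , cons s q , r

  -- A path with its nodes numbered, possibly with repetitions; `reach` makes the rules applicable
  -- at every position.
  record Chain {V} (G : Graph V) (a b : V) : Set where
    field
      size     : ℕ
      at       : ℕ → V
      at-start : at 0 ≡ a
      at-end   : at size ≡ b
      linked   : ∀ {i} → i < size → E G (code next) (at i) (at (suc i))
      reach    : ∀ i → RPath G nextStar a (at i)
  open Chain

  point : ∀ {V} {G : Graph V} {a} → Chain G a a
  point {a = a} = record
    -- Positions past the end repeat the last node, so rules can be instantiated at all numbers.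
    { size = 0 ; at = λ _ → a ; at-start = refl ; at-end = refl
    ; linked = λ () ; reach = λ _ → [] , star0 , nil }

  extend : ∀ {V} {G : Graph V} {a d b} → E G (code next) a d → Chain G d b → Chain G a b
  extend {V} {G} {a} e c = record
    { size = suc (size c) ; at = at′ ; at-start = refl ; at-end = at-end c
    ; linked = linked′ ; reach = reach′ }
    where
    at′ : ℕ → V
    at′ zero    = a
    at′ (suc i) = at c i
    linked′ : ∀ {i} → i < suc (size c) → E G (code next) (at′ i) (at′ (suc i))
    linked′ {zero}  _       = subst (E G (code next) a) (sym (at-start c)) e
    linked′ {suc i} (s≤s l) = linked c l
    reach′ : ∀ i → RPath G nextStar a (at′ i)
    reach′ zero    = [] , star0 , nil
    reach′ (suc i) with w , l , p ← reach c i = lFwd (code next) ∷ w , starS fwd l , cons e p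

  starChain : ∀ {V} {G : Graph V} {w a b} → Lang nextStar w → WPath G w a b → Chain G a b
  starChain star0         nil        = point
  starChain (starS fwd l) (cons e p) = extend e (starChain l p)

  inputChain : ∀ {V} {G : Graph V} n {w a b} → Lang (inputRoute n) w → WPath G w a b →
               Σ (Chain G a b) λ c → n ≤ size c × Un G 0 (at c n) × b ≡ Cn G 1
  inputChain {G = G} zero (seq uu (seq {w₁ = v} l cc)) (cons (refl , u) p)
    with split v p
  ... | _ , q , cons (refl , e) nil =
    let c = starChain l q in c , z≤n , subst (Un G 0) (sym (at-start c)) u , e
  inputChain (suc n) (seq fwd l) (cons e p)
    with c , le , u , eq ← inputChain n l p = extend e c , s≤s le , u , eq

  -- The negated constraint yields its path only under double negation, which suffices for the goal
  -- `⊥`. Edges are then pulled back along the numbering of the path.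
  extract : ∀ Γ n → Satisfiable (lAnd (theory Γ) (inputIs n)) →
            (∀ B H → n ≤ B → (∀ {i} → i < B → H next i (suc i)) → Valid n B H Γ → ⊥) → ⊥
  extract Γ n (V , G , sat , ¬none) k = ¬none λ { a (w , l , p) ρ _ _ _ → onPath l p }
    where
    onPath : ∀ {w a} → Lang (inputRoute n) w → WPath G w (Cn G 0) a → ⊥
    onPath l p with inputChain n l p
    ... | c , le , u , refl = k (size c) H le (linked c) (valid Γ sat)
      where
      H : Lab → ℕ → ℕ → Set
      H l i j = E G (code l) (at c i) (at c j)

      travel : ∀ a i → Anchored n (size c) H a i → RPath G (route a) (Cn G 0) (at c i)
      travel anywhere i _ = reach c i
      travel atZero   _ refl = [] , eps , subst (WPath G [] (Cn G 0)) (sym (at-start c)) nil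
      travel atInput  _ refl with w , l , p ← reach c n =
        w ++ lU 0 ∷ [] , seq l uu , p ++ᵖ cons (refl , u) nil

      conclude : ∀ {k} (d : Concl k) ι → ⟦_⟧Q G (conclQF d) (λ x → at c (ι x)) →
                 Concluded n (size c) H d ι
      conclude (edge _)       ι h = h
      -- Equal positions carry equal nodes, so disequality passes from nodes to positions; the
      -- converse can fail when the path revisits a node.
      conclude (x ≠ zeroMark) ι h e = h (trans (cong (at c) e) (at-start c))
      conclude (x ≠ endMark)  ι h e = h (trans (cong (at c) e) (at-end c))

      valid : ∀ Γ → _⊨_ G (theory Γ) → Valid n (size c) H Γ
      valid [ rule k a ps d ] s ι an hs =
        conclude d ι (s _ (travel a _ an) (λ x → at c (ι x)) refl (All.map⁺ hs))
      valid (Γ ∧ Δ) (s , t) = valid Γ s , valid Δ t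

  -- The nodes are all of ℕ and next-edges continue beyond `B`, which only constant 1 singles out.
  -- Evaluation can thus be interpreted without a bound.
  realize : ∀ Γ n B H → n ≤ B → (∀ i → H next i (suc i)) → Valid n B H Γ →
            Satisfiable (lAnd (theory Γ) (inputIs n))
  realize Γ n B H n≤B hs v =
    ℕ , G , satisfied Γ v , λ none → none B input (λ _ → B) refl [] refl
    where
    G : Graph ℕ
    G = record
      -- Graph labels are arbitrary numbers, so `H` is transported along `code`; injectivity
      -- recovers it in `lower`.
      { E  = λ l i j → Σ Lab λ m → code m ≡ l × H m i j
      ; Cn = λ { 0 → 0 ; 1 → B ; (suc (suc _)) → 0 }
      ; Un = λ _ i → i ≡ n }

    arrive : ∀ a {i} → RPath G (route a) 0 i → Anchored n B H a i
    arrive anywhere _ = tt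
    arrive atZero   (_ , eps , nil) = refl
    arrive atInput  (_ , seq {w₁ = w} _ uu , p) with split w p
    ... | _ , _ , cons (refl , e) nil = e

    lower : ∀ {l i j} → E G (code l) i j → H l i j
    lower {i = i} {j} (_ , e , h) = subst (λ l → H l i j) (code-injective e) h

    conclude : ∀ {k} (d : Concl k) ι → Concluded n B H d ι → ⟦_⟧Q G (conclQF d) ι
    conclude (edge (_ , l , _)) ι h = l , refl , h
    conclude (x ≠ zeroMark)     ι h = h
    conclude (x ≠ endMark)      ι h = h

    satisfied : ∀ Γ → Valid n B H Γ → _⊨_ G (theory Γ)
    satisfied [ rule k a ps d ] v _ p ι refl hs =
      conclude d ι (v ι (arrive a p) (All.map lower (All.map⁻ hs)))
    satisfied (Γ ∧ Δ) (v , w) = satisfied Γ v , satisfied Δ w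

    ahead : ∀ i d {j} → i + d ≡ j → RPath G nextStar i j
    ahead i zero    refl = [] , star0 , subst (WPath G [] i) (sym (+-identityʳ i)) nil
    ahead i (suc d) e with w , l , p ← ahead (suc i) d (trans (sym (+-suc i d)) e) =
      lFwd (code next) ∷ w , starS fwd l , cons (next , refl , hs i) p

    approach : ∀ i m → i + m ≡ n → RPath G (inputRoute m) i B
    approach i zero e with i≡n ← trans (sym (+-identityʳ i)) e
      with d , le ← m≤n⇒∃[o]m+o≡n n≤B
      with w , l , p ← ahead i d (trans (cong (_+ d) i≡n) le) =
      _ , seq uu (seq l cc) , cons (refl , i≡n) (p ++ᵖ cons (refl , refl) nil)
    approach i (suc m) e with w , l , p ← approach (suc i) m (trans (sym (+-suc i m)) e) =
      _ , seq fwd l , cons (next , refl , hs i) p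

    input : RPath G (inputRoute n) 0 B
    input = approach 0 n refl

-- Unary programs over paired numbers

infixr 9 _⊚_
data Prog : Set where
  prim      : Fin 6 → Prog
  ⟨_,_⟩ _⊚_ : Prog → Prog → Prog
  loop      : Prog → Prog

pattern zeroP = prim 0F
pattern idP   = prim 1F
pattern sucP  = prim 2F
pattern predP = prim 3F
pattern fstP  = prim 4F
pattern sndP  = prim 5F

-- OK is required of the results of the two operations that can produce a number
-- larger than their arguments.  loop f iterates f while the first component is nonzero.
data Run (OK : ℕ → Set) : Prog → ℕ → ℕ → Set where
  run-zero : ∀ {x} → Run OK zeroP x 0
  run-id   : ∀ {x} → Run OK idP x x
  run-suc  : ∀ {x} → OK (suc x) → Run OK sucP x (suc x)
  run-pred : ∀ {x} → Run OK predP (suc x) x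
  run-fst  : ∀ {x a b} → x ≡ a ⋆ b → Run OK fstP x a
  run-snd  : ∀ {x a b} → x ≡ a ⋆ b → Run OK sndP x b
  run-pair : ∀ {f g x y z} → Run OK f x y → Run OK g x z → OK (y ⋆ z) →
             Run OK ⟨ f , g ⟩ x (y ⋆ z)
  run-comp : ∀ {f g x y z} → Run OK g x y → Run OK f y z → Run OK (f ⊚ g) x z
  run-stop : ∀ {f x y} → x ≡ 0 ⋆ y → Run OK (loop f) x y
  run-step : ∀ {f x k r x′ y} → x ≡ suc k ⋆ r → Run OK f x x′ → Run OK (loop f) x′ y →
             Run OK (loop f) x y

Halts : Prog → ℕ → ℕ → Set
Halts = Run (λ _ → ⊤)

Run-map : ∀ {P Q : ℕ → Set} → (∀ {x} → P x → Q x) → ∀ {f x y} → Run P f x y → Run Q f x y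
Run-map h run-zero         = run-zero
Run-map h run-id           = run-id
Run-map h (run-suc p)      = run-suc (h p)
Run-map h run-pred         = run-pred
Run-map h (run-fst e)      = run-fst e
Run-map h (run-snd e)      = run-snd e
Run-map h (run-pair r s p) = run-pair (Run-map h r) (Run-map h s) (h p)
Run-map h (run-comp r s)   = run-comp (Run-map h r) (Run-map h s)
Run-map h (run-stop e)     = run-stop e
Run-map h (run-step e r s) = run-step e (Run-map h r) (Run-map h s)

-- The two size conditions may differ, so that a bounded run behind a demand can be compared with an
-- unbounded evaluation.
Run-functional : ∀ {P Q f x y z} → Run P f x y → Run Q f x z → y ≡ z
Run-functional run-zero    run-zero    = refl
Run-functional run-id      run-id      = refl
Run-functional (run-suc _) (run-suc _) = refl
Run-functional run-pred    run-pred    = refl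
Run-functional (run-fst e) (run-fst d) = proj₁ (⋆-injective (trans (sym e) d))
Run-functional (run-snd e) (run-snd d) = proj₂ (⋆-injective (trans (sym e) d))
Run-functional (run-pair r s _) (run-pair r′ s′ _) =
  cong₂ _⋆_ (Run-functional r r′) (Run-functional s s′)
Run-functional (run-comp r s) (run-comp r′ s′) with refl ← Run-functional r r′ =
  Run-functional s s′
Run-functional (run-stop e) (run-stop d) = proj₂ (⋆-injective (trans (sym e) d))
Run-functional (run-stop e) (run-step d _ _)
  with () ← proj₁ (⋆-injective (trans (sym e) d))
Run-functional (run-step e _ _) (run-stop d)
  with () ← proj₁ (⋆-injective (trans (sym e) d))
Run-functional (run-step _ r s) (run-step _ r′ s′) with refl ← Run-functional r r′ =
  Run-functional s s′

-- A halting run creates only finitely many numbers; their maximum tells how long a chain suffices.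
Run-bounded : ∀ {f x y} → Halts f x y → Σ ℕ λ B → Run (_≤ B) f x y
Run-bounded run-zero    = 0 , run-zero
Run-bounded run-id      = 0 , run-id
Run-bounded (run-suc _) = _ , run-suc ≤-refl
Run-bounded run-pred    = 0 , run-pred
Run-bounded (run-fst e) = 0 , run-fst e
Run-bounded (run-snd e) = 0 , run-snd e
Run-bounded (run-pair {y = y} {z} r s _) with A , r′ ← Run-bounded r | B , s′ ← Run-bounded s =
  A ⊔ B ⊔ (y ⋆ z) ,
  run-pair (Run-map (λ l → ≤-trans l (≤-trans (m≤m⊔n A B) (m≤m⊔n (A ⊔ B) _))) r′)
           (Run-map (λ l → ≤-trans l (≤-trans (m≤n⊔m A B) (m≤m⊔n (A ⊔ B) _))) s′)
           (m≤n⊔m (A ⊔ B) _)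
Run-bounded (run-comp r s) with A , r′ ← Run-bounded r | B , s′ ← Run-bounded s =
  A ⊔ B , run-comp (Run-map (λ l → ≤-trans l (m≤m⊔n A B)) r′)
                   (Run-map (λ l → ≤-trans l (m≤n⊔m A B)) s′)
Run-bounded (run-stop e) = 0 , run-stop e
Run-bounded (run-step e r s) with A , r′ ← Run-bounded r | B , s′ ← Run-bounded s =
  A ⊔ B , run-step e (Run-map (λ l → ≤-trans l (m≤m⊔n A B)) r′)
                     (Run-map (λ l → ≤-trans l (m≤n⊔m A B)) s′)

-- Edge labels and the rules axiomatising evaluation.

data Lab : Set where
  ev dm : Prog → Lab
  dp    : Lab

progTag : Prog → ℕ
progTag (prim _)  = 0
progTag ⟨ _ , _ ⟩ = 1
progTag (_ ⊚ _)   = 2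
progTag (loop _)  = 3

progCode : Prog → ℕ
progBody : Prog → ℕ
progCode f = progTag f ⋆ progBody f
progBody (prim i)  = toℕ i
progBody ⟨ f , g ⟩ = progCode f ⋆ progCode g
progBody (f ⊚ g)   = progCode f ⋆ progCode g
progBody (loop f)  = progCode f

progCode-injective : ∀ {f g} → progCode f ≡ progCode g → f ≡ g
progCode-injective {f} {g} e = let t , b = ⋆-injective e in go f g t b
  where
  go : ∀ f g → progTag f ≡ progTag g → progBody f ≡ progBody g → f ≡ g
  go (prim _)  (prim _)  refl b = cong prim (toℕ-injective b)
  go ⟨ _ , _ ⟩ ⟨ _ , _ ⟩ refl b = let b₁ , b₂ = ⋆-injective b in
    cong₂ ⟨_,_⟩ (progCode-injective b₁) (progCode-injective b₂)
  go (_ ⊚ _)   (_ ⊚ _)   refl b = let b₁ , b₂ = ⋆-injective b in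
    cong₂ _⊚_ (progCode-injective b₁) (progCode-injective b₂)
  go (loop _)  (loop _)  refl b = cong loop (progCode-injective b)

labTag labBody labCode : Lab → ℕ
labTag (ev _) = 0
labTag (dm _) = 1
labTag dp     = 2
labBody (ev f) = progCode f
labBody (dm f) = progCode f
labBody dp     = 0
labCode l = labTag l ⋆ labBody l

labCode-injective : ∀ {l m} → labCode l ≡ labCode m → l ≡ m
labCode-injective {l} {m} e = let t , b = ⋆-injective e in go l m t b
  where
  go : ∀ l m → labTag l ≡ labTag m → labBody l ≡ labBody m → l ≡ m
  go (ev _) (ev _) refl b = cong ev (progCode-injective b)
  go (dm _) (dm _) refl b = cong dm (progCode-injective b)
  go dp     dp     refl _ = refl

open Horn Lab labCode labCode-injective (ev sucP)

-- The rules below are read with nodes as numbers ≤ B: ev f relates x to the result of f on x,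
-- a loop dm f at x demands the value of f on x, and dp from a to b demands pair a b.
-- A demand whose answer exceeds B clashes with the end mark.

diagPremises : ∀ {k} → List (Edge (5 + k))
diagPremises = (0F , ev fstP , 3F) ∷ (0F , ev sndP , 4F) ∷
               (2F , ev sucP , 3F) ∷ (4F , ev sucP , 5F) ∷ (0F , ev sucP , 1F) ∷ []

resetPremises : ∀ {k} → List (Edge (4 + k))
resetPremises = (1F , ev fstP , 0F) ∷ (1F , ev sndP , 3F) ∷
                (3F , ev sucP , 4F) ∷ (1F , ev sucP , 2F) ∷ []

-- The equations `⋆-origin`, `⋆-suc` and `⋆-zero` read as rules. In `diagPremises` the variables are
-- w, w+1, a, a+1, b, b+1 with w coding (a+1, b); in `resetPremises` they are 0, w, w+1, a, a+1 with
-- w coding (0, a).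
projRules : Rules
projRules =
    [ rule 0 atZero [] (edge (0F , ev fstP , 0F)) ]
  ∧ [ rule 0 atZero [] (edge (0F , ev sndP , 0F)) ]
  ∧ [ rule 5 anywhere diagPremises (edge (1F , ev fstP , 2F)) ]
  ∧ [ rule 5 anywhere diagPremises (edge (1F , ev sndP , 5F)) ]
  ∧ [ rule 4 atZero resetPremises (edge (2F , ev fstP , 4F)) ]
  ∧ [ rule 4 atZero resetPremises (edge (2F , ev sndP , 0F)) ]

-- A demand travels back along the enumeration: (a, b+1) demands (a+1, b), and (a+1, 0) demands (0,
-- a). Once the predecessor has value w, the demand forbids w to be the end. The first rule ensures
-- that a+1 exists.
pairRules : Rules
pairRules =
    [ rule 2 anywhere ((0F , dp , 2F) ∷ (1F , ev sucP , 2F) ∷ []) (0F ≠ endMark) ]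
  ∧ [ rule 3 anywhere ((0F , dp , 3F) ∷ (0F , ev sucP , 1F) ∷ (2F , ev sucP , 3F) ∷ [])
        (edge (1F , dp , 2F)) ]
  ∧ [ rule 4 anywhere ((0F , dp , 3F) ∷ (0F , ev sucP , 1F) ∷ (2F , ev sucP , 3F) ∷
                       (4F , ev fstP , 1F) ∷ (4F , ev sndP , 2F) ∷ []) (4F ≠ endMark) ]
  ∧ [ rule 2 atZero ((2F , dp , 0F) ∷ (1F , ev sucP , 2F) ∷ []) (edge (0F , dp , 1F)) ]
  ∧ [ rule 3 atZero ((2F , dp , 0F) ∷ (1F , ev sucP , 2F) ∷
                     (3F , ev fstP , 0F) ∷ (3F , ev sndP , 1F) ∷ []) (3F ≠ endMark) ]

primRules : Rules
primRules =
    [ rule 0 anywhere [] (edge (0F , ev idP , 0F)) ]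
  -- Variable 0 is taken by the number 0, so the reflexive `idP` edge brings the arbitrary argument
  -- into scope.
  ∧ [ rule 1 atZero ((1F , ev idP , 1F) ∷ []) (edge (1F , ev zeroP , 0F)) ]
  ∧ [ rule 1 anywhere ((0F , ev sucP , 1F) ∷ []) (edge (1F , ev predP , 0F)) ]

coreRules : Rules
coreRules = projRules ∧ pairRules ∧ primRules

-- Demands flow from a program to its parts, evaluations from the parts to the program.
progRules : Prog → Rules
-- Among the primitives only `sucP` can exceed `B`, so one rule serves all six.
progRules (prim _) = [ rule 0 anywhere ((0F , dm sucP , 0F) ∷ []) (0F ≠ endMark) ]
progRules ⟨ f , g ⟩ =
    ( [ rule 0 anywhere ((0F , dm ⟨ f , g ⟩ , 0F) ∷ []) (edge (0F , dm f , 0F)) ]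
    ∧ [ rule 0 anywhere ((0F , dm ⟨ f , g ⟩ , 0F) ∷ []) (edge (0F , dm g , 0F)) ]
    ∧ [ rule 2 anywhere ((0F , dm ⟨ f , g ⟩ , 0F) ∷ (0F , ev f , 1F) ∷ (0F , ev g , 2F) ∷ [])
          (edge (1F , dp , 2F)) ]
    ∧ [ rule 3 anywhere ((0F , ev f , 1F) ∷ (0F , ev g , 2F) ∷
                         (3F , ev fstP , 1F) ∷ (3F , ev sndP , 2F) ∷ [])
          (edge (0F , ev ⟨ f , g ⟩ , 3F)) ])
  ∧ progRules f ∧ progRules g
progRules (f ⊚ g) =
    ( [ rule 0 anywhere ((0F , dm (f ⊚ g) , 0F) ∷ []) (edge (0F , dm g , 0F)) ]
    ∧ [ rule 1 anywhere ((0F , dm (f ⊚ g) , 0F) ∷ (0F , ev g , 1F) ∷ []) (edge (1F , dm f , 1F)) ]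
    ∧ [ rule 2 anywhere ((0F , ev g , 1F) ∷ (1F , ev f , 2F) ∷ []) (edge (0F , ev (f ⊚ g) , 2F)) ])
  ∧ progRules f ∧ progRules g
progRules (loop f) =
    ( [ rule 2 anywhere ((0F , dm (loop f) , 0F) ∷ (0F , ev fstP , 2F) ∷ (1F , ev sucP , 2F) ∷ [])
          (edge (0F , dm f , 0F)) ]
    ∧ [ rule 3 anywhere ((0F , dm (loop f) , 0F) ∷ (0F , ev fstP , 2F) ∷ (1F , ev sucP , 2F) ∷
                         (0F , ev f , 3F) ∷ [])
          (edge (3F , dm (loop f) , 3F)) ]
    ∧ [ rule 2 atZero ((1F , ev fstP , 0F) ∷ (1F , ev sndP , 2F) ∷ [])
          (edge (1F , ev (loop f) , 2F)) ]
    ∧ [ rule 4 anywhere ((0F , ev fstP , 2F) ∷ (1F , ev sucP , 2F) ∷ (0F , ev f , 3F) ∷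
                         (3F , ev (loop f) , 4F) ∷ [])
          (edge (0F , ev (loop f) , 4F)) ])
  ∧ progRules f

inputRules : Prog → Rules
inputRules f =
    [ rule 0 atInput [] (edge (0F , dm f , 0F)) ]
  -- A result is 1 exactly when its predecessor `2F` is 0, so excluding the zero mark excludes the
  -- result 1.
  ∧ [ rule 2 atInput ((0F , ev f , 1F) ∷ (2F , ev sucP , 1F) ∷ (1F , ev zeroP , 2F) ∷ [])
        (2F ≠ zeroMark) ]

notOne : Prog → Rules
notOne f = inputRules f ∧ progRules f ∧ coreRules

-- Soundness: what the rules force in every model.

module Forced {n B : ℕ} {H : Lab → ℕ → ℕ → Set}
              (linked : ∀ {i} → i < B → H (ev sucP) i (suc i)) where

  projections : Valid n B H projRules → ∀ {w} a b → w ≡ a ⋆ b → w ≤ B →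
                H (ev fstP) w a × H (ev sndP) w b
  projections (z₁ , z₂ , d₁ , d₂ , r₁ , r₂) = ⋆-elim
    (λ w a b → w ≤ B → H (ev fstP) w a × H (ev sndP) w b)
    (λ _ → z₁ (0 ◃ ∅) refl [] , z₂ (0 ◃ ∅) refl [])
    (λ {w} {a} {b} e ih w<B →
      let p , q = ih (<⇒≤ w<B)
          a<w = subst (suc a ≤_) (sym e) (fst≤⋆ (suc a) b)
          b≤w = subst (b ≤_) (sym e) (snd≤⋆ (suc a) b)
          ι   = w ◃ suc w ◃ a ◃ suc a ◃ b ◃ suc b ◃ ∅
          ps  = p ∷ q ∷ linked (≤-trans a<w (<⇒≤ w<B)) ∷ linked (≤-<-trans b≤w w<B) ∷
                linked w<B ∷ []
      in d₁ ι tt ps , d₂ ι tt ps)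
    (λ {w} {a} e ih w<B →
      let p , q = ih (<⇒≤ w<B)
          a≤w = subst (a ≤_) (sym e) (snd≤⋆ 0 a)
          ι   = 0 ◃ w ◃ suc w ◃ a ◃ suc a ◃ ∅
          ps  = p ∷ q ∷ linked (≤-<-trans a≤w w<B) ∷ linked w<B ∷ []
      in r₁ ι refl ps , r₂ ι refl ps)

  -- The demand descends to the predecessor pair, whose value w is at most `B` by induction. Then
  -- `projections` identifies w as that pair, and the rule excluding w = `B` leaves room for w+1.
  pair-fits : Valid n B H projRules → Valid n B H pairRules →
              ∀ {w} a b → w ≡ a ⋆ b → a ≤ B → b ≤ B → H dp a b → w ≤ B
  pair-fits projs (d₁ , d₂ , d₃ , r₁ , r₂) = ⋆-elim
    (λ w a b → a ≤ B → b ≤ B → H dp a b → w ≤ B)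
    (λ _ _ _ → z≤n)
    (λ {w} {a} {b} e ih a≤B b<B h →
      let a<B   = ≤∧≢⇒< a≤B (d₁ (a ◃ b ◃ suc b ◃ ∅) tt (h ∷ linked b<B ∷ []))
          h′    = d₂ (a ◃ suc a ◃ b ◃ suc b ◃ ∅) tt (h ∷ linked a<B ∷ linked b<B ∷ [])
          w≤B   = ih a<B (<⇒≤ b<B) h′
          p , q = projections projs (suc a) b e w≤B
      in ≤∧≢⇒< w≤B (d₃ (a ◃ suc a ◃ b ◃ suc b ◃ w ◃ ∅) tt
                       (h ∷ linked a<B ∷ linked b<B ∷ p ∷ q ∷ [])))
    (λ {w} {a} e ih a<B _ h →
      let h′    = r₁ (0 ◃ a ◃ suc a ◃ ∅) refl (h ∷ linked a<B ∷ [])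
          w≤B   = ih z≤n (<⇒≤ a<B) h′
          p , q = projections projs 0 a e w≤B
      in ≤∧≢⇒< w≤B (r₂ (0 ◃ a ◃ suc a ◃ w ◃ ∅) refl (h ∷ linked a<B ∷ p ∷ q ∷ [])))

  -- Induction on the run rather than the program, since `loop` re-enters its own rules. The bound
  -- is carried along because successor edges are given only below `B`.
  evaluate : Valid n B H coreRules → ∀ {f x y} → Valid n B H (progRules f) → Halts f x y →
             x ≤ B → H (dm f) x x → y ≤ B × H (ev f) x y
  evaluate (_ , _ , iᵣ , zᵣ , _) {x = x} _ run-zero _ _ =
    z≤n , zᵣ (0 ◃ x ◃ ∅) refl (iᵣ (x ◃ ∅) tt [] ∷ [])
  evaluate (_ , _ , iᵣ , _) {x = x} _ run-id x≤B _ = x≤B , iᵣ (x ◃ ∅) tt []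
  evaluate _ {x = x} sᵣ (run-suc _) x≤B d =
    let x<B = ≤∧≢⇒< x≤B (sᵣ (x ◃ ∅) tt (d ∷ [])) in x<B , linked x<B
  evaluate (_ , _ , _ , _ , pᵣ) {y = y} _ run-pred y<B _ =
    <⇒≤ y<B , pᵣ (y ◃ suc y ◃ ∅) tt (linked y<B ∷ [])
  evaluate (projs , _) _ (run-fst {a = a} {b} e) x≤B _ =
    ≤-trans (subst (a ≤_) (sym e) (fst≤⋆ a b)) x≤B , proj₁ (projections projs a b e x≤B)
  evaluate (projs , _) _ (run-snd {a = a} {b} e) x≤B _ =
    ≤-trans (subst (b ≤_) (sym e) (snd≤⋆ a b)) x≤B , proj₂ (projections projs a b e x≤B)
  evaluate c@(projs , pairs , _) {x = x} ((d₁ , d₂ , d₃ , e₁) , vf , vg)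
           (run-pair {y = y} {z} r s _) x≤B d =
    let y≤B , hy = evaluate c vf r x≤B (d₁ (x ◃ ∅) tt (d ∷ []))
        z≤B , hz = evaluate c vg s x≤B (d₂ (x ◃ ∅) tt (d ∷ []))
        w≤B      = pair-fits projs pairs y z refl y≤B z≤B
                     (d₃ (x ◃ y ◃ z ◃ ∅) tt (d ∷ hy ∷ hz ∷ []))
        p , q    = projections projs y z refl w≤B
    in w≤B , e₁ (x ◃ y ◃ z ◃ (y ⋆ z) ◃ ∅) tt (hy ∷ hz ∷ p ∷ q ∷ [])
  evaluate c {x = x} {z} ((d₁ , d₂ , e₁) , vf , vg) (run-comp {y = y} r s) x≤B d =
    let y≤B , hy = evaluate c vg r x≤B (d₁ (x ◃ ∅) tt (d ∷ []))
        z≤B , hz = evaluate c vf s y≤B (d₂ (x ◃ y ◃ ∅) tt (d ∷ hy ∷ []))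
    in z≤B , e₁ (x ◃ y ◃ z ◃ ∅) tt (hy ∷ hz ∷ [])
  evaluate (projs , _) {x = x} {y} ((_ , _ , e₁ , _) , _) (run-stop e) x≤B _ =
    let p , q = projections projs 0 y e x≤B
    in ≤-trans (subst (y ≤_) (sym e) (snd≤⋆ 0 y)) x≤B ,
       e₁ (0 ◃ x ◃ y ◃ ∅) refl (p ∷ q ∷ [])
  evaluate c@(projs , _) {x = x} {y} v@((d₁ , d₂ , _ , e₂) , vf)
           (run-step {k = k} {r = r} {x′ = x′} e s t) x≤B d =
    let p , _      = projections projs (suc k) r e x≤B
        hk         = linked (≤-trans (subst (suc k ≤_) (sym e) (fst≤⋆ (suc k) r)) x≤B)
        x′≤B , hx′ = evaluate c vf s x≤B (d₁ (x ◃ k ◃ suc k ◃ ∅) tt (d ∷ p ∷ hk ∷ []))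
        y≤B , hy   = evaluate c v t x′≤B
                       (d₂ (x ◃ k ◃ suc k ◃ x′ ◃ ∅) tt (d ∷ p ∷ hk ∷ hx′ ∷ []))
    in y≤B , e₂ (x ◃ k ◃ suc k ◃ x′ ◃ y ◃ ∅) tt (p ∷ hk ∷ hx′ ∷ hy ∷ [])

-- Every model must contain the evaluation edge from `n` to 1, and the last input rule then makes 0
-- differ from itself.
notOne-sound : ∀ f {n} → Halts f n 1 → ¬ Satisfiable (lAnd (theory (notOne f)) (inputIs n))
notOne-sound f {n} r sat = extract (notOne f) n sat λ where
  B H n≤B linked ((i₁ , i₂) , v , c@(_ , _ , iᵣ , zᵣ , _)) →
    let open Forced {n} {B} {H} linked
        1≤B , h = evaluate c v r n≤B (i₁ (n ◃ ∅) refl [])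
    in i₂ (n ◃ 1 ◃ 0 ◃ ∅) refl
          (h ∷ linked 1≤B ∷ zᵣ (0 ◃ 1 ◃ ∅) refl (iᵣ (1 ◃ ∅) tt [] ∷ []) ∷ []) refl

-- Completeness: the intended model.

module Intended (n B : ℕ) where

  -- Evaluation is unbounded, while a demand means that a run within `B` exists. A demand thus
  -- already guarantees that its answer fits, which validates the end-mark rules.
  H : Lab → ℕ → ℕ → Set
  H (ev f) x y = Halts f x y
  H (dm f) x _ = Σ ℕ λ y → Run (_≤ B) f x y
  H dp     a b = a ⋆ b ≤ B

  suc⁻¹ : ∀ {x y} → Halts sucP x y → y ≡ suc x
  suc⁻¹ (run-suc _) = refl

  projections⁻¹ : ∀ {w a b} → Halts fstP w a → Halts sndP w b → w ≡ a ⋆ b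
  projections⁻¹ {a = a} (run-fst e) (run-snd d) =
    trans e (cong (a ⋆_) (proj₂ (⋆-injective (trans (sym e) d))))

  diag⁻¹ : ∀ {w w′ a a′ b b′} → Halts fstP w a′ → Halts sndP w b → Halts sucP a a′ →
           Halts sucP b b′ → Halts sucP w w′ → w′ ≡ a ⋆ b′
  diag⁻¹ {a = a} {b = b} p q (run-suc _) (run-suc _) (run-suc _) =
    trans (cong suc (projections⁻¹ p q)) (sym (⋆-suc a b))

  reset⁻¹ : ∀ {z w w′ b b′} → z ≡ 0 → Halts fstP w z → Halts sndP w b → Halts sucP b b′ →
            Halts sucP w w′ → w′ ≡ b′ ⋆ z
  reset⁻¹ {b = b} refl p q (run-suc _) (run-suc _) =
    trans (cong suc (projections⁻¹ p q)) (sym (⋆-zero b))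

  projValid : Valid n B H projRules
  projValid =
      (λ { ι e [] → run-fst {b = 0} (subst (λ z → z ≡ z ⋆ 0) (sym e) (sym ⋆-origin)) })
    , (λ { ι e [] → run-snd {a = 0} (subst (λ z → z ≡ 0 ⋆ z) (sym e) (sym ⋆-origin)) })
    , (λ { ι _ (p ∷ q ∷ r ∷ s ∷ t ∷ []) → run-fst (diag⁻¹ p q r s t) })
    , (λ { ι _ (p ∷ q ∷ r ∷ s ∷ t ∷ []) → run-snd (diag⁻¹ p q r s t) })
    , (λ { ι e (p ∷ q ∷ r ∷ s ∷ []) → run-fst (reset⁻¹ e p q r s) })
    , (λ { ι e (p ∷ q ∷ r ∷ s ∷ []) → run-snd (reset⁻¹ e p q r s) })

  descend : ∀ {a b b′} → Halts sucP b b′ → a ⋆ b′ ≤ B → suc a ⋆ b < B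
  descend {a} {b} (run-suc _) = subst (_≤ B) (⋆-suc a b)

  descendZero : ∀ {z a a′} → z ≡ 0 → Halts sucP a a′ → a′ ⋆ z ≤ B → z ⋆ a < B
  descendZero {a = a} refl (run-suc _) = subst (_≤ B) (⋆-zero a)

  pairValid : Valid n B H pairRules
  pairValid =
      (λ { ι _ (h ∷ s ∷ []) → <⇒≢ (≤-trans (fst≤⋆ (suc (ι 0F)) (ι 1F)) (<⇒≤ (descend s h))) })
    , (λ { ι _ (h ∷ r ∷ s ∷ []) →
           subst (λ a′ → a′ ⋆ ι 2F ≤ B) (sym (suc⁻¹ r)) (<⇒≤ (descend s h)) })
    , (λ { ι _ (h ∷ r ∷ s ∷ p ∷ q ∷ []) →
           <⇒≢ (subst (_< B) (sym (trans (projections⁻¹ p q) (cong (λ a′ → a′ ⋆ ι 2F) (suc⁻¹ r))))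
                 (descend s h)) })
    , (λ { ι e (h ∷ s ∷ []) → <⇒≤ (descendZero e s h) })
    , (λ { ι e (h ∷ s ∷ p ∷ q ∷ []) →
           <⇒≢ (subst (_< B) (sym (projections⁻¹ p q)) (descendZero e s h)) })

  primValid : Valid n B H primRules
  primValid =
      (λ { ι _ [] → run-id })
    , (λ { ι e (_ ∷ []) → subst (Halts zeroP (ι 1F)) (sym e) run-zero })
    , (λ { ι _ (s ∷ []) → subst (λ x → Halts predP x (ι 0F)) (sym (suc⁻¹ s)) run-pred })

  -- A successor as first component rules out `run-stop`, so the demanded run splits into one pass
  -- of the body and the rest.
  loopDemand : ∀ {f x k k′} → H (dm (loop f)) x x → Halts fstP x k′ → Halts sucP k k′ →
               Σ ℕ λ x′ → Run (_≤ B) f x x′ × H (dm (loop f)) x′ x′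
  loopDemand (_ , run-step _ r s)          _           _           = _ , r , _ , s
  loopDemand (_ , run-stop e) (run-fst d) (run-suc _)
    with () ← proj₁ (⋆-injective (trans (sym e) d))

  progValid : ∀ f → Valid n B H (progRules f)
  progValid (prim _) = λ { ι _ ((_ , run-suc x<B) ∷ []) → <⇒≢ x<B }
  progValid ⟨ f , g ⟩ =
      ( (λ { ι _ ((_ , run-pair r _ _) ∷ []) → _ , r })
      , (λ { ι _ ((_ , run-pair _ s _) ∷ []) → _ , s })
      -- Determinism identifies the results on the edges with those of the demanded run, whose pair
      -- is known to fit.
      , (λ { ι _ ((_ , run-pair r s p) ∷ r′ ∷ s′ ∷ []) →
             subst (_≤ B) (cong₂ _⋆_ (Run-functional r r′) (Run-functional s s′)) p })
      , (λ { ι _ (r ∷ s ∷ p ∷ q ∷ []) →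
             subst (Halts ⟨ f , g ⟩ (ι 0F)) (sym (projections⁻¹ p q)) (run-pair r s tt) }))
    , progValid f , progValid g
  progValid (f ⊚ g) =
      ( (λ { ι _ ((_ , run-comp r _) ∷ []) → _ , r })
      , (λ { ι _ ((z , run-comp r s) ∷ r′ ∷ []) →
             z , subst (λ y → Run (_≤ B) f y z) (Run-functional r r′) s })
      , (λ { ι _ (r ∷ s ∷ []) → run-comp r s }))
    , progValid f , progValid g
  progValid (loop f) =
      ( (λ { ι _ (d ∷ p ∷ s ∷ []) → let _ , r , _ = loopDemand d p s in _ , r })
      , (λ { ι _ (d ∷ p ∷ s ∷ r′ ∷ []) → let _ , r , d′ = loopDemand d p s in
             subst (λ x → H (dm (loop f)) x x) (Run-functional r r′) d′ })
      , (λ { ι e (p ∷ q ∷ []) →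
             run-stop (trans (projections⁻¹ p q) (cong (λ z → z ⋆ ι 2F) e)) })
      , (λ { ι _ (p ∷ s ∷ r ∷ t ∷ []) → step p s r t }))
    , progValid f
    where
    step : ∀ {x k k′ x′ y} → Halts fstP x k′ → Halts sucP k k′ → Halts f x x′ →
           Halts (loop f) x′ y → Halts (loop f) x y
    step (run-fst e) (run-suc _) r t = run-step e r t

  coreValid : Valid n B H coreRules
  coreValid = projValid , pairValid , primValid

notOne-complete : ∀ f {n y} → Halts f n y → y ≢ 1 →
                  Satisfiable (lAnd (theory (notOne f)) (inputIs n))
notOne-complete f {n} {y} r y≢1 with A , r′ ← Run-bounded r =
  -- `A` bounds the numbers the run creates; joining `n` puts the input on the chain.
  realize (notOne f) n (A ⊔ n) H (m≤n⊔m A n) (λ _ → run-suc tt)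
    (inputValid , progValid f , coreValid)
  where
  open Intended n (A ⊔ n)
  inputValid : Valid n (A ⊔ n) H (inputRules f)
  inputValid =
      (λ { ι refl [] → y , Run-map (λ l → ≤-trans l (m≤m⊔n A n)) r′ })
    , (λ { ι refl (t ∷ s ∷ _ ∷ []) e →
           y≢1 (trans (Run-functional r t) (trans (suc⁻¹ s) (cong suc e))) })

-- Compiling recursive functions to unary programs

enc : ∀ {k} → Vec ℕ k → ℕ
enc []       = 0
enc (x ∷ xs) = x ⋆ enc xs

nth : ∀ {k} → Fin k → Prog
nth Fin.zero    = fstP
nth (Fin.suc i) = nth i ⊚ sndP

-- State (k , i , r , xs) with i + k the recursion argument and r the value at i.
precStep : Prog → Prog
precStep g = ⟨ predP ⊚ fstP , ⟨ sucP ⊚ fstP ⊚ sndP , ⟨ g ⊚ sndP , sndP ⊚ sndP ⊚ sndP ⟩ ⟩ ⟩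

-- State (f (z , xs) , z , xs).
muEnter : Prog → Prog
muEnter f = ⟨ f , idP ⟩

muStep : Prog → Prog
muStep f = muEnter f ⊚ ⟨ sucP ⊚ fstP ⊚ sndP , sndP ⊚ sndP ⟩

compile    : ∀ {k} → Rec k → Prog
compileAll : ∀ {k m} → Vec (Rec k) m → Prog
compile zer         = zeroP
compile succ        = sucP ⊚ fstP
compile (proj i)    = nth i
compile (comp f gs) = compile f ⊚ compileAll gs
compile (prec f g)  =
  -- The loop starts at (n, 0, f xs, xs) and drops its exhausted counter, leaving (n, r, xs).
  (fstP ⊚ sndP ⊚ loop (precStep (compile g))) ⊚ ⟨ fstP , ⟨ zeroP , ⟨ compile f ⊚ sndP , sndP ⟩ ⟩ ⟩
compile (mu f)      =
  -- The search starts at z = 0; a zero value of f stops the loop and leaves (z, xs).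
  fstP ⊚ loop (muStep (compile f)) ⊚ muEnter (compile f) ⊚ ⟨ zeroP , idP ⟩
compileAll []       = zeroP
compileAll (g ∷ gs) = ⟨ compile g , compileAll gs ⟩

on-fst : ∀ {a b} → Halts fstP (a ⋆ b) a
on-fst = run-fst refl

on-snd : ∀ {a b} → Halts sndP (a ⋆ b) b
on-snd = run-snd refl

nth-correct : ∀ {k} (i : Fin k) (xs : Vec ℕ k) → Halts (nth i) (enc xs) (lookupV xs i)
nth-correct Fin.zero    (x ∷ xs) = on-fst
nth-correct (Fin.suc i) (x ∷ xs) = run-comp on-snd (nth-correct i xs)

precStep-correct : ∀ {g k i r v y} → Halts g (i ⋆ r ⋆ v) y →
                   Halts (precStep g) (suc k ⋆ i ⋆ r ⋆ v)
                                      (k ⋆ suc i ⋆ y ⋆ v)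
precStep-correct h =
  run-pair (run-comp on-fst run-pred)
    (run-pair (run-comp (run-comp on-snd on-fst) (run-suc tt))
      (run-pair (run-comp on-snd h) (run-comp (run-comp on-snd on-snd) on-snd) tt) tt) tt

muEnter-correct : ∀ {f x y} → Halts f x y → Halts (muEnter f) x (y ⋆ x)
muEnter-correct h = run-pair h run-id tt

muStep-correct : ∀ {f m z v y} → Halts f (suc z ⋆ v) y →
                 Halts (muStep f) (m ⋆ z ⋆ v) (y ⋆ suc z ⋆ v)
muStep-correct h = run-comp
  (run-pair (run-comp (run-comp on-snd on-fst) (run-suc tt)) (run-comp on-snd on-snd) tt)
  (muEnter-correct h)

-- Induction on the distance `d` from the candidate `z` to the least zero `y`.
search : ∀ {f v y} → Halts f (y ⋆ v) 0 →
         (∀ z → z < y → Σ ℕ λ m → Halts f (z ⋆ v) (suc m)) →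
         ∀ d z → z + d ≡ y →
         Σ ℕ λ m → Halts f (z ⋆ v) m × Halts (loop (muStep f)) (m ⋆ z ⋆ v) (y ⋆ v)
search h below zero z e with refl ← trans (sym (+-identityʳ z)) e = 0 , h , run-stop refl
search h below (suc d) z e
  with m , p ← below z (subst (z <_) e (m<m+n z (s≤s z≤n)))
     | m′ , p′ , l ← search h below d (suc z) (trans (sym (+-suc z d)) e) =
  suc m , p , run-step refl (muStep-correct p′) l

compile-correct    : ∀ {k} {f : Rec k} {xs y} → Eval f xs y → Halts (compile f) (enc xs) y
compileAll-correct : ∀ {k m} {gs : Vec (Rec k) m} {xs ys} → EvalAll gs xs ys →
                     Halts (compileAll gs) (enc xs) (enc ys)
compile-below      : ∀ {k} {f : Rec (suc k)} {xs y} →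
                     (∀ z → z < y → Σ ℕ λ m → Eval f (z ∷ xs) (suc m)) →
                     ∀ z → z < y → Σ ℕ λ m → Halts (compile f) (z ⋆ enc xs) (suc m)
-- The loop is followed in continuation style because the counter at which it is entered
-- grows along the induction on the evaluation of the recursion.
compile-prec       : ∀ {k} {f : Rec k} {g n xs r} → Eval (prec f g) (n ∷ xs) r →
                     Σ ℕ λ r₀ → Halts (compile f) (enc xs) r₀ ×
                     (∀ m {s z} → n + m ≡ s →
                      Halts (loop (precStep (compile g))) (m ⋆ n ⋆ r ⋆ enc xs) z →
                      Halts (loop (precStep (compile g))) (s ⋆ 0 ⋆ r₀ ⋆ enc xs) z)
prec-correct       : ∀ {k} {f : Rec k} {g n xs r} → Eval (prec f g) (n ∷ xs) r →
                     Halts (compile (prec f g)) (n ⋆ enc xs) r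

compile-correct eZer  = run-zero
compile-correct eSucc = run-comp on-fst (run-suc tt)
compile-correct (eProj {i = i} {xs}) = nth-correct i xs
compile-correct (eComp es e) = run-comp (compileAll-correct es) (compile-correct e)
compile-correct e@(ePrec0 _)   = prec-correct e
compile-correct e@(ePrecS _ _) = prec-correct e
compile-correct (eMu {y = y} e below)
  with m , p , l ← search (compile-correct e) (compile-below below) y 0 refl =
  run-comp (run-comp (run-comp (run-pair run-zero run-id tt) (muEnter-correct p)) l) on-fst

compileAll-correct []       = run-zero
compileAll-correct (e ∷ es) = run-pair (compile-correct e) (compileAll-correct es) tt

compile-below below z z<y with m , e ← below z z<y = m , compile-correct e

compile-prec (ePrec0 e) = _ , compile-correct e , λ { _ refl l → l }
compile-prec {n = suc n} (ePrecS e e′) with r₀ , h , k ← compile-prec e =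
  r₀ , h , λ m eq l → k (suc m) (trans (+-suc n m) eq)
                        (run-step refl (precStep-correct (compile-correct e′)) l)

prec-correct {n = n} e with r₀ , h , k ← compile-prec e = run-comp
  (run-pair on-fst (run-pair run-zero (run-pair (run-comp on-snd h) on-snd tt) tt) tt)
  (run-comp (run-comp (k 0 (+-identityʳ n) (run-stop refl)) on-snd) on-fst)

-- The diagonal formula

konst : ℕ → Prog
konst zero    = zeroP
konst (suc k) = sucP ⊚ konst k

konst-correct : ∀ k {x} → Halts (konst k) x k
konst-correct zero    = run-zero
konst-correct (suc k) = run-comp (konst-correct k) (run-suc tt)

opaque
  unfolding _⋆_

  -- Stating this and `conjCode` for variables confines the unfolding of pairing to this block.
  seqCode : ∀ R S → encR (rSeq R S) ≡ 8 ⋆ encR R ⋆ encR S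
  seqCode R S = refl

  conjCode : ∀ ψ R (q : QF 1) → ⌜ lAnd ψ (lNot (atom (rc 0 R 0 [] q))) ⌝ ≡
             2 ⋆ ⌜ ψ ⌝ ⋆ 1 ⋆ 0 ⋆ 0 ⋆ encR R ⋆ 0 ⋆ 0 ⋆ encQ q
  conjCode ψ R q = refl

fwdCode : ℕ
fwdCode = encR (rFwd (labCode (ev sucP)))

-- State (counter, code): each pass wraps the code in one more leading next-edge.
routeStep : Prog
routeStep = ⟨ predP ⊚ fstP , ⟨ konst 8 , ⟨ konst fwdCode , sndP ⟩ ⟩ ⟩

routeCode : Prog
routeCode = loop routeStep ⊚ ⟨ idP , konst (encR toEnd) ⟩

routeLoop-correct : ∀ n m {s} → n + m ≡ s →
                    Halts (loop routeStep) (n ⋆ encR (inputRoute m)) (encR (inputRoute s))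
routeLoop-correct zero    m refl = run-stop refl
routeLoop-correct (suc n) m e    = run-step refl
  (run-pair (run-comp on-fst run-pred)
            (subst (Halts _ _) (sym (seqCode (rFwd (labCode (ev sucP))) (inputRoute m)))
              (run-pair (konst-correct 8) (run-pair (konst-correct fwdCode) on-snd tt) tt)) tt)
  (routeLoop-correct n (suc m) (trans (+-suc n m) e))

routeCode-correct : ∀ n → Halts routeCode n (encR (inputRoute n))
routeCode-correct n = run-comp (run-pair run-id (konst-correct (encR toEnd)) tt)
                               (routeLoop-correct n 0 (+-identityʳ n))

opaque
  -- Opacity keeps the type checker from expanding the numerals into programs.
  diagonal : Prog
  diagonal =
    ⟨ ⟨ konst 2 , ⟨ idP , ⟨ konst 1 , ⟨ konst 0 , ⟨ konst 0 ,
      ⟨ routeCode , ⟨ konst 0 , ⟨ konst 0 , konst (encQ absurdQ) ⟩ ⟩ ⟩ ⟩ ⟩ ⟩ ⟩ ⟩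
    , zeroP ⟩

  -- The components follow `conjCode`; the outer pairing with 0 makes the one-element argument
  -- vector expected by compiled programs.
  diagonal-correct : ∀ ψ → Halts diagonal ⌜ ψ ⌝ (enc (⌜ lAnd ψ (inputIs ⌜ ψ ⌝) ⌝ ∷ []))
  diagonal-correct ψ = run-pair
    (subst (Halts _ _) (sym (conjCode ψ (inputRoute ⌜ ψ ⌝) absurdQ))
      (prepend 2 (run-pair run-id (prepend 1 (prepend 0 (prepend 0
        (run-pair (routeCode-correct ⌜ ψ ⌝) (prepend 0 (prepend 0 (konst-correct (encQ absurdQ)))) tt))))
        tt)))
    run-zero tt
    where
    prepend : ∀ k {f x y} → Halts f x y → Halts ⟨ konst k , f ⟩ x (k ⋆ y)
    prepend k r = run-pair (konst-correct k) r tt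

-- The output `b` of `f` is a verdict on the formula denying that `f` outputs 1: the verdict 1
-- contradicts `notOne-sound`, any other `notOne-complete`.
notOne-undecided : ∀ f {ψ n b} → ψ ≡ theory (notOne f) → Halts f n b →
                   let φ = lAnd ψ (inputIs n) in
                   (b ≡ 1 → Satisfiable φ) × (Satisfiable φ → b ≡ 1) → ⊥
notOne-undecided f {b = b} refl r (to , from) with b ≟ 1
... | yes refl = notOne-sound f r (to refl)
... | no b≢1   = b≢1 (from (notOne-complete f r b≢1))

-- Naming ψ only up to an equation keeps the type checker from evaluating its Gödel number.
self-refuting : ∀ ψ D → ψ ≡ theory (notOne (compile D ⊚ diagonal)) → ¬ DecidesLRPSat D
self-refuting ψ D e decides =
  let f             = compile D ⊚ diagonal
      _ , run , iff = decides (lAnd ψ (inputIs ⌜ ψ ⌝))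
                        (lAnd (subst WF (sym e) (theoryWF (notOne f))) (inputWF ⌜ ψ ⌝))
  in notOne-undecided f e (run-comp (diagonal-correct ψ) (compile-correct run)) iff

theorem2 : ¬ (Σ (Rec 1) λ D → DecidesLRPSat D)
theorem2 (D , decides) =
  self-refuting (theory (notOne (compile D ⊚ diagonal))) D refl decides
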